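{- Let $G=\langle V,E,S,D,L\rangle$ be a labeled multistage graph. If there exists a simple path in $G$, then after the execution of the Z-H algorithm (on input $G$) we get $\mathrm{Comp}(E(D),D,R(E))\neq\emptyset$.
   Context: A labeled multistage graph $G=\langle V,E,S,D,L\rangle$ is a directed graph such that: (1) $V=V_0\cup V_1\cup\dots\cup V_L$ is the vertex set, with $V_i\cap V_j=\emptyset$ for $0\le i,j\le L$, $i\neq j$; a vertex $u\in V_i$ is said to be of stage $i$; (2) $E$ is the set of directed edges, each written as a triple $\langle u,v,l\rangle$ (an edge of stage $l$), where $1\le l\le L$, $u\in V_{l-1}$, $v\in V_l$; (3) $V_0=\{S\}$ and $V_L=\{D\}$; (4) each $v\in V\setminus\{S\}$ is labeled with a subset $E(v)\subseteq E$. A simple path in $G$ is a path $S-u_1-\dots-u_l-\dots-u_L$ with $u_L=D$ such that for every $l\in\{1,\dots,L\}$ all edges on $S-u_1-\dots-u_l$ are contained in $E(u_l)$. Notation. For an edge set $ES\subseteq E$, $ES[i:j]$ is the set of all edges of $ES$ from stage $i$ to stage $j$ (empty if $i>j$). For $u,v\in V$, $[ES]_u^v$ is the set of $e\in ES$ such that $e$ is on a path $u-\dots-v$ all of whose edges are contained in $ES$. For each edge $e=\langle u,v,l\rangle\in E$ the algorithm maintains a set $R(e)=R(u,v,l)\subseteq E$; $R(E)=\{R(e)\mid e\in E\}$ is a global variable. Operator $\mathrm{Init}(R(u,v,l))$: (1) $ES\leftarrow\{\langle a,b,k\rangle\in E\mid l<k\le L,\ \langle u,v,l\rangle\in E(a)\cap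 E(b)\}$; (2) $R(u,v,l)\leftarrow[ES]_v^D$. Operator $\mathrm{Comp}(ES,v,R(E))$, for $ES\subseteq E$, $v\in V$, is the final value of $T$ in: (1) $T\leftarrow ES$; (2) for all $e=\langle a,b,k\rangle\in T$: if $[R(a,b,k)\cap T]_b^v$ contains no path from $b$ to $v$, then $T\leftarrow T\setminus\{e\}$; (3) $T\leftarrow[T]_S^v$; (4) repeat (2) and (3) until $T$ does not change any more. Operator $\mathrm{Change}(R(u,v,l))$: (1) for all $\langle a,b,k\rangle\in R(u,v,l)$, $l<k\le L$: if $\mathrm{Comp}\big([\{e\mid e=\langle c,d,kk\rangle\in E,\ kk<l,\ [R(e)\cap\mathrm{Comp}(E(b),b,R(E))]_d^b \text{ contains } \langle u,v,l\rangle \text{ and } \langle a,b,k\rangle\}]_S^u,\ u,\ R(E)\big)\neq\emptyset$, then $\langle a,b,k\rangle$ is kept in $R(u,v,l)$, else $\langle a,b,k\rangle$ is deleted from $R(u,v,l)$; (2) $R(u,v,l)\leftarrow[R(u,v,l)]_v^D$; (3) repeat (1) and (2) until $R(u,v,l)$ does not change any more. Z-H algorithm, input $G=\langle V,E,S,D,L\rangle$: 1. For all $e\in E$, generate $R(e)$ by $\mathrm{Init}$. 2. For $l=1$ to $L-1$: (2.1) for all edges $\langle u,v,l\rangle$ of stage $l$, call $\mathrm{Change}(R(u,v,l))$ to modify $R(u,v,l)$; (2.2) for all $v$ of stage $l$, $E(v)\leftarrow\mathrm{Comp}(E(v),v,R(E))$; (2.3) for all $\langle a,b,k\rangle\in E$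 with $k\le l$, replace the part $R(a,b,k)[k+1:l]$ of $R(a,b,k)$ by $\bigcup_{v\in V_l}[R(a,b,k)\cap\mathrm{Comp}(E(v),v,R(E))]_b^v$, then set $R(a,b,k)\leftarrow[R(a,b,k)]_b^D$. 3. Repeat step 2 until no $R(u,v,l)$ in $R(E)$ changes any more. 4. If $\mathrm{Comp}(E(D),D,R(E))\neq\emptyset$, claim the existence of a simple path in $G$; otherwise claim that there is no simple path in $G$.
   Formalization: In Change, the test Comp(…)≠∅ counts as passed when u=S (edges of stage 1). Taken literally it is always false there, so every R(S,v,1) is emptied and the claim fails for L≥2, e.g. for the graph S→a→D with E(a)={Sa}, E(D)={Sa,aD}. -}

module Defs where

open import Data.Bool.Base using (if_then_else_; true)
import Data.Bool.Properties as Bool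
open import Data.Fin.Base using (Fin; zero; suc; inject₁; fromℕ)
  renaming (_≤_ to _≤ᶠ_)
open import Data.Fin.Properties using (any?; all?) renaming (_≟_ to _≟ᶠ_)
open import Data.Fin.Subset
open import Data.Fin.Subset.Properties
open import Data.List.Base using (List; []; _∷_; filter; foldl; allFin; applyUpTo)
import Data.List.Base as List
open import Data.Nat.Base using (ℕ; zero; suc; _+_; _∸_; _≤_; _<_)
open import Data.Nat.Induction using (<-wellFounded)
import Data.Nat.Properties as ℕ
open import Data.Product.Base using (Σ; ∃; _×_; _,_; proj₁; proj₂)
open import Data.Sum.Base using (_⊎_; inj₁; inj₂; [_,_]′)
import Data.Empty as Empty
open import Data.Vec.Base using (tabulate)
open import Data.Vec.Functional using (updateAt)
import Data.Vec.Functional as Vector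
open import Data.Vec.Functional.Properties using (updateAt-updates; updateAt-minimal)
open import Data.Vec.Properties
  using (≡-dec; lookup⇒[]=; []=⇒lookup; lookup∘tabulate)
open import Function.Base using (_∘_; id; const)
open import Level using (0ℓ)
open import Induction.WellFounded using (Acc; acc)
open import Relation.Binary.Construct.Closure.ReflexiveTransitive
  using (Star; ε; _◅_)
open import Relation.Binary.PropositionalEquality
  using (_≡_; _≢_; refl; sym; trans; cong; subst)
open import Relation.Nullary using (¬_; Dec; does; yes; no; contradiction)
open import Relation.Nullary.Decidable
  using (⌊_⌋; map′; ¬?; _×-dec_; _⊎-dec_; dec-true)
open import Relation.Unary using (Pred; Decidable)

private
  variable
    n : ℕ

------------------------------------------------------------------------
-- Finite subsets

_≟ˢ_ : (p q : Subset n) → Dec (p ≡ q)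
_≟ˢ_ = ≡-dec Bool._≟_

⟪_⟫ : ∀ {P : Pred (Fin n) 0ℓ} → Decidable P → Subset n
⟪ P? ⟫ = tabulate (does ∘ P?)

∈⟪⟫⁺ : ∀ {P : Pred (Fin n) 0ℓ} (P? : Decidable P) {x} → P x → x ∈ ⟪ P? ⟫
∈⟪⟫⁺ P? {x} px =
  lookup⇒[]= x _ (trans (lookup∘tabulate (does ∘ P?) x) (dec-true (P? x) px))

∈⟪⟫⁻ : ∀ {P : Pred (Fin n) 0ℓ} (P? : Decidable P) {x} → x ∈ ⟪ P? ⟫ → P x
∈⟪⟫⁻ P? {x} x∈ with P? x | trans (sym (lookup∘tabulate (does ∘ P?) x)) ([]=⇒lookup x∈)
... | yes px | _  = px
... | no  _  | ()

⊆⇒≡⊎∣<∣ : (p q : Subset n) → p ⊆ q → p ≡ q ⊎ ∣ p ∣ < ∣ q ∣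
⊆⇒≡⊎∣<∣ p q p⊆q with any? (λ x → (x ∈? q) ×-dec ¬? (x ∈? p))
... | yes w = inj₂ (p⊂q⇒∣p∣<∣q∣ (p⊆q , w))
... | no ¬w = inj₁ (⊆-antisym p⊆q q⊆p)
  where
  q⊆p : q ⊆ p
  q⊆p {x} x∈q with x ∈? p
  ... | yes x∈p = x∈p
  ... | no  x∉p = contradiction (x , x∈q , x∉p) ¬w

∣_∣ᶠ : ∀ {m} → (Fin m → Subset n) → ℕ
∣ f ∣ᶠ = Vector.foldr _+_ 0 (∣_∣ ∘ f)

⊆⇒∣∣ᶠ≤ : ∀ {m} (f g : Fin m → Subset n) → (∀ i → f i ⊆ g i) → ∣ f ∣ᶠ ≤ ∣ g ∣ᶠ
⊆⇒∣∣ᶠ≤ {m = zero}  f g f⊆g = ℕ.≤-refl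
⊆⇒∣∣ᶠ≤ {m = suc m} f g f⊆g =
  ℕ.+-mono-≤ (p⊆q⇒∣p∣≤∣q∣ (f⊆g zero)) (⊆⇒∣∣ᶠ≤ (f ∘ suc) (g ∘ suc) (f⊆g ∘ suc))

⊆⇒≡⊎∣<∣ᶠ : ∀ {m} (f g : Fin m → Subset n) → (∀ i → f i ⊆ g i) →
           (∀ i → g i ≡ f i) ⊎ ∣ f ∣ᶠ < ∣ g ∣ᶠ
⊆⇒≡⊎∣<∣ᶠ {m = zero}  f g f⊆g = inj₁ λ ()
⊆⇒≡⊎∣<∣ᶠ {m = suc m} f g f⊆g
  with ⊆⇒≡⊎∣<∣ (f zero) (g zero) (f⊆g zero)
     | ⊆⇒≡⊎∣<∣ᶠ (f ∘ suc) (g ∘ suc) (f⊆g ∘ suc)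
... | inj₂ lt | _       = inj₂ (ℕ.+-mono-<-≤ lt (⊆⇒∣∣ᶠ≤ (f ∘ suc) (g ∘ suc) (f⊆g ∘ suc)))
... | inj₁ _  | inj₂ lt = inj₂ (ℕ.+-mono-≤-< (p⊆q⇒∣p∣≤∣q∣ (f⊆g zero)) lt)
... | inj₁ eq | inj₁ h  = inj₁ λ { zero → sym eq ; (suc i) → h i }

------------------------------------------------------------------------
-- Loops

-- The edges and vertices of a graph are visited in the order of their numbers;
-- as the numbering is arbitrary, so is this order.

forEach : {A B : Set} → List A → (A → B → B) → B → B
forEach xs body s = foldl (λ s x → body x s) s xs

forEach-inv : {A B : Set} (P : B → Set) (body : A → B → B) →
              (∀ x s → P s → P (body x s)) →
              ∀ xs s → P s → P (forEach xs body s)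
forEach-inv P body step []       s ps = ps
forEach-inv P body step (x ∷ xs) s ps =
  forEach-inv P body step xs (body x s) (step x s ps)

if-elim : {A B : Set} (P : B → Set) (a? : Dec A) {x y : B} →
          (A → P x) → (¬ A → P y) → P (if ⌊ a? ⌋ then x else y)
if-elim P (yes a) px py = px a
if-elim P (no ¬a) px py = py ¬a

-- Execute `body` until an execution leaves the state unchanged in the sense of
-- `Unchanged`; the measure `μ` is only there to justify termination.  `repeat`
-- is opaque because normalising nested loops is prohibitively expensive.

module Repeat {A : Set} (body : A → A)
              {Unchanged : A → A → Set}
              (unchanged? : ∀ s t → Dec (Unchanged s t))
              (μ : A → ℕ)
              (decreases : ∀ s → ¬ Unchanged s (body s) → μ (body s) < μ s)
              where

  go : ∀ s → Acc _<_ (μ s) → A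
  go s (acc rs) with unchanged? s (body s)
  ... | yes _   = body s
  ... | no  ¬eq = go (body s) (rs (decreases s ¬eq))

  opaque
    repeat : A → A
    repeat s = go s (<-wellFounded (μ s))

    repeat-inv : (P : A → Set) → (∀ s → P s → P (body s)) →
                 ∀ s → P s → P (repeat s)
    repeat-inv P step s = go-inv s (<-wellFounded (μ s))
      where
      go-inv : ∀ s (a : Acc _<_ (μ s)) → P s → P (go s a)
      go-inv s (acc rs) ps with unchanged? s (body s)
      ... | yes _   = step s ps
      ... | no  ¬eq = go-inv (body s) (rs (decreases s ¬eq)) (step s ps)

------------------------------------------------------------------------
-- Labeled multistage graphs

-- V_i is the set of vertices v with stage v ≡ i.  Edges are numbered; as the
-- triples ⟨u,v,l⟩ form a set, an edge is determined by its two end points, and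
-- its stage l is the stage of its target.  E(v) is only meaningful for v ≢ S:
-- nothing below depends on the value label S.  As D is a labeled vertex of
-- V∖{S}, a multistage graph has L ≥ 1.

record LabeledMultistageGraph : Set where
  field
    L nV nE : ℕ
    1≤L     : 1 ≤ L

  Vertex : Set
  Vertex = Fin nV

  Edge : Set
  Edge = Fin nE

  EdgeSet : Set
  EdgeSet = Subset nE

  field
    stage   : Vertex → ℕ
    stage≤L : ∀ v → stage v ≤ L

    src tgt  : Edge → Vertex
    src-tgt  : ∀ e → stage (tgt e) ≡ suc (stage (src e))
    edge-ext : ∀ {e f} → src e ≡ src f → tgt e ≡ tgt f → e ≡ f

    S D      : Vertex
    stage-S  : stage S ≡ 0
    only-S   : ∀ {v} → stage v ≡ 0 → v ≡ S
    stage-D  : stage D ≡ L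
    only-D   : ∀ {v} → stage v ≡ L → v ≡ D

    label    : Vertex → EdgeSet

  stageᵉ : Edge → ℕ
  stageᵉ e = stage (tgt e)

record SimplePath (G : LabeledMultistageGraph) : Set where
  open LabeledMultistageGraph G
  field
    vertex   : Fin (suc L) → Vertex
    edge     : Fin L → Edge
    starts   : vertex zero ≡ S
    ends     : vertex (fromℕ L) ≡ D
    edge-src : ∀ i → src (edge i) ≡ vertex (inject₁ i)
    edge-tgt : ∀ i → tgt (edge i) ≡ vertex (suc i)
    labeled  : ∀ {i l : Fin L} → i ≤ᶠ l → edge i ∈ label (vertex (suc l))

------------------------------------------------------------------------
-- The algorithm

module Operators (G : LabeledMultistageGraph) where
  open LabeledMultistageGraph G

  Step : EdgeSet → Vertex → Vertex → Set
  Step X u v = ∃ λ e → e ∈ X × src e ≡ u × tgt e ≡ v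

  -- Includes the trivial path from a vertex to itself.
  Path : EdgeSet → Vertex → Vertex → Set
  Path X = Star (Step X)

  infix 4 _onPath_
  _onPath_ : ∀ {X u v} → Edge → Path X u v → Set
  e onPath ε             = Empty.⊥
  e onPath ((f , _) ◅ p) = e ≡ f ⊎ e onPath p

  path? : ∀ X u v → Dec (Path X u v)
  path? X u v = search L u (ℕ.m∸n≤m L (stage u))
    where
    search : ∀ k u → L ∸ stage u ≤ k → Dec (Path X u v)
    search k u bound with u ≟ᶠ v
    search k       u bound | yes refl = yes ε
    search zero    u bound | no u≢v = no λ
      { ε → u≢v refl
      ; ((e , _ , refl , refl) ◅ _) →
          ℕ.<⇒≱ (subst (_≤ L) (src-tgt e) (stage≤L (tgt e)))
                (ℕ.m∸n≡0⇒m≤n (ℕ.n≤0⇒n≡0 bound)) }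
    search (suc k) u bound | no u≢v = map′ to from (any? next?)
      where
      Next : Edge → Set
      Next e = e ∈ X × src e ≡ u × Path X (tgt e) v

      bound′ : ∀ e → src e ≡ u → L ∸ stage (tgt e) ≤ k
      bound′ e refl = subst (λ s → L ∸ s ≤ k) (sym (src-tgt e))
        (subst (_≤ k) (ℕ.pred[m∸n]≡m∸[1+n] L (stage u)) (ℕ.pred-mono-≤ bound))

      next? : Decidable Next
      next? e with e ∈? X | src e ≟ᶠ u
      ... | no  e∉X | _      = no (e∉X ∘ proj₁)
      ... | yes _   | no s≢u = no (s≢u ∘ proj₁ ∘ proj₂)
      ... | yes e∈X | yes s≡u =
        map′ (λ p → e∈X , s≡u , p) (proj₂ ∘ proj₂)
             (search k (tgt e) (bound′ e s≡u))

      to : ∃ Next → Path X u v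
      to (e , e∈X , s≡u , p) = (e , e∈X , s≡u , refl) ◅ p

      from : Path X u v → ∃ Next
      from ε = contradiction refl u≢v
      from ((e , e∈X , s≡u , refl) ◅ p) = e , e∈X , s≡u , p

  OnSomePath : EdgeSet → Vertex → Vertex → Edge → Set
  OnSomePath X u v e = Σ (Path X u v) (e onPath_)

  join : ∀ {X u v e} → e ∈ X → Path X u (src e) → Path X (tgt e) v →
         OnSomePath X u v e
  join {X} {u} {v} {e} e∈X p q = go p
    where
    go : ∀ {w} → Path X w (src e) → OnSomePath X w v e
    go ε       = (e , e∈X , refl , refl) ◅ q , inj₁ refl
    go (s ◅ p) = s ◅ proj₁ (go p) , inj₂ (proj₂ (go p))

  split : ∀ {X u v e} → OnSomePath X u v e →
          e ∈ X × Path X u (src e) × Path X (tgt e) v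
  split ((f , f∈X , refl , refl) ◅ p , inj₁ refl) = f∈X , ε , p
  split (s ◅ p , inj₂ e∈p) with split (p , e∈p)
  ... | e∈X , q , r = e∈X , s ◅ q , r

  onSomePath? : ∀ X u v → Decidable (OnSomePath X u v)
  onSomePath? X u v e =
    map′ (λ { (e∈X , p , q) → join e∈X p q }) split
         ((e ∈? X) ×-dec path? X u (src e) ×-dec path? X (tgt e) v)

  infix 8 [_]_⇝_
  [_]_⇝_ : EdgeSet → Vertex → Vertex → EdgeSet
  [ X ] u ⇝ v = ⟪ onSomePath? X u v ⟫

  []⊆ : ∀ X u v → [ X ] u ⇝ v ⊆ X
  []⊆ X u v = proj₁ ∘ split ∘ ∈⟪⟫⁻ (onSomePath? X u v)

  Between : EdgeSet → ℕ → ℕ → Edge → Set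
  Between X i j e = e ∈ X × i ≤ stageᵉ e × stageᵉ e ≤ j

  between? : ∀ X i j → Decidable (Between X i j)
  between? X i j e = (e ∈? X) ×-dec (i ℕ.≤? stageᵉ e) ×-dec (stageᵉ e ℕ.≤? j)

  infix 8 _[_∶_]
  _[_∶_] : EdgeSet → ℕ → ℕ → EdgeSet
  X [ i ∶ j ] = ⟪ between? X i j ⟫

  edges : List Edge
  edges = allFin nE

  vertices : List Vertex
  vertices = allFin nV

  elements : EdgeSet → List Edge
  elements X = filter (_∈? X) edges

  edgesOfStage : ℕ → List Edge
  edgesOfStage l = filter (λ e → stageᵉ e ℕ.≟ l) edges

  edgesUpToStage : ℕ → List Edge
  edgesUpToStage l = filter (λ e → stageᵉ e ℕ.≤? l) edges

  verticesOfStage : ℕ → List Vertex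
  verticesOfStage l = filter (λ v → stage v ℕ.≟ l) vertices

  -- The family R(E), and the labels E(v), which change during execution.
  RFamily : Set
  RFamily = Edge → EdgeSet

  Labels : Set
  Labels = Vertex → EdgeSet

  infix 4 _⊑_
  _⊑_ : RFamily → RFamily → Set
  R′ ⊑ R = ∀ e → R′ e ⊆ R e

  ⊑-trans : ∀ R R′ R″ → R ⊑ R′ → R′ ⊑ R″ → R ⊑ R″
  ⊑-trans R R′ R″ p q e = q e ∘ p e

  ----------------------------------------------------------------------
  -- Init

  InitEdge : Labels → Edge → Edge → Set
  InitEdge E e f = stageᵉ e < stageᵉ f × e ∈ E (src f) ∩ E (tgt f)

  initEdge? : ∀ E e → Decidable (InitEdge E e)
  initEdge? E e f = (stageᵉ e ℕ.<? stageᵉ f) ×-dec (e ∈? E (src f) ∩ E (tgt f))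

  Init : Labels → Edge → EdgeSet
  Init E e = [ ⟪ initEdge? E e ⟫ ] tgt e ⇝ D

  ----------------------------------------------------------------------
  -- Comp

  module CompLoop (v : Vertex) (R : RFamily) where

    prune : Edge → EdgeSet → EdgeSet
    prune e T =
      if ⌊ path? ([ R e ∩ T ] tgt e ⇝ v) (tgt e) v ⌋ then T else T - e

    body : EdgeSet → EdgeSet
    body T = [ forEach (elements T) prune T ] S ⇝ v

    prune-⊆ : ∀ e T → prune e T ⊆ T
    prune-⊆ e T =
      if-elim (_⊆ T) (path? ([ R e ∩ T ] tgt e ⇝ v) (tgt e) v)
        (λ _ → id) (λ _ → p─q⊆p T ⁅ e ⁆)

    body-⊆ : ∀ T → body T ⊆ T
    body-⊆ T = ⊆-trans ([]⊆ _ S v)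
      (forEach-inv (_⊆ T) prune (λ e U U⊆T → ⊆-trans (prune-⊆ e U) U⊆T)
        (elements T) T id)

    decreases : ∀ T → T ≢ body T → ∣ body T ∣ < ∣ T ∣
    decreases T T≢ =
      [ (λ eq → contradiction (sym eq) T≢) , id ]′ (⊆⇒≡⊎∣<∣ (body T) T (body-⊆ T))

    open Repeat body _≟ˢ_ ∣_∣ decreases public

  Comp : EdgeSet → Vertex → RFamily → EdgeSet
  Comp ES v R = CompLoop.repeat v R ES

  ----------------------------------------------------------------------
  -- Change

  module ChangeLoop (E : Labels) (e : Edge) where

    u v : Vertex
    u = src e
    v = tgt e

    l : ℕ
    l = stageᵉ e

    Candidate : RFamily → Edge → Edge → Set
    Candidate R f g = stageᵉ g < l × e ∈ X × f ∈ X
      where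
      b : Vertex
      b = tgt f

      X : EdgeSet
      X = [ R g ∩ Comp (E b) b R ] tgt g ⇝ b

    candidate? : ∀ R f → Decidable (Candidate R f)
    candidate? R f g = (stageᵉ g ℕ.<? l) ×-dec (e ∈? _) ×-dec (f ∈? _)

    candidates : RFamily → Edge → EdgeSet
    candidates R f = ⟪ candidate? R f ⟫

    -- Comp X u R, for X a set of edges on paths S-…-u, stands for a family of
    -- paths S-…-u.  For l = 1 we have u = S and there are no edges of stage
    -- < l; the trivial path S is then such a path, so the test ≠∅ is passed
    -- (otherwise every R(S,v,1) would be emptied on any input, and hence
    -- Comp (E D) D R would always be empty for L ≥ 2).
    Keep : RFamily → Edge → Set
    Keep R f = u ≡ S ⊎ Nonempty (Comp ([ candidates R f ] S ⇝ u) u R)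

    keep? : ∀ R f → Dec (Keep R f)
    keep? R f = (u ≟ᶠ S) ⊎-dec nonempty? _

    test : Edge → RFamily → RFamily
    test f R = if ⌊ keep? R f ⌋ then R else updateAt R e (_- f)

    restrict : RFamily → RFamily
    restrict R = updateAt R e ([_] v ⇝ D)

    body : RFamily → RFamily
    body R = restrict
      (forEach (filter (λ f → l ℕ.<? stageᵉ f) (elements (R e))) test R)

    updateAt-⊑ : ∀ R d {h} → h (R d) ⊆ R d → updateAt R d h ⊑ R
    updateAt-⊑ R d {h} h⊆ f with f ≟ᶠ d
    ... | yes refl = subst (_⊆ R d) (sym (updateAt-updates d R)) h⊆
    ... | no  f≢d  = subst (_⊆ R f) (sym (updateAt-minimal f d R f≢d)) id

    test-⊑ : ∀ f R → test f R ⊑ R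
    test-⊑ f R =
      if-elim (_⊑ R) (keep? R f)
        (λ _ _ → id) (λ _ → updateAt-⊑ R e (p─q⊆p (R e) ⁅ f ⁆))

    body-⊑ : ∀ R → body R ⊑ R
    body-⊑ R = ⊑-trans (restrict R′) R′ R
      (updateAt-⊑ R′ e ([]⊆ (R′ e) v D))
      (forEach-inv (_⊑ R) test (λ f R″ → ⊑-trans (test f R″) R″ R (test-⊑ f R″))
        fs R (λ _ → id))
      where
      fs : List Edge
      fs = filter (λ f → l ℕ.<? stageᵉ f) (elements (R e))

      R′ : RFamily
      R′ = forEach fs test R

    decreases : ∀ R → R e ≢ body R e → ∣ body R e ∣ < ∣ R e ∣
    decreases R R≢ =
      [ (λ eq → contradiction (sym eq) R≢) , id ]′
        (⊆⇒≡⊎∣<∣ (body R e) (R e) (body-⊑ R e))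

    open Repeat body (λ R R′ → R e ≟ˢ R′ e) (λ R → ∣ R e ∣) decreases public

    repeat-⊑ : ∀ R → repeat R ⊑ R
    repeat-⊑ R = repeat-inv (_⊑ R) (λ R′ → ⊑-trans (body R′) R′ R (body-⊑ R′)) R
      (λ _ → id)

  -- The family R(E) resulting from the call Change(R(e)).
  Change : Labels → Edge → RFamily → RFamily
  Change E e = ChangeLoop.repeat E e

  ----------------------------------------------------------------------
  -- The Z-H algorithm

  record State : Set where
    constructor state
    field
      R : RFamily
      E : Labels

  open State

  step₂₁ : ℕ → State → State
  step₂₁ l (state R E) = state (forEach (edgesOfStage l) (Change E) R) E

  step₂₂ : ℕ → State → State
  step₂₂ l (state R E) =
    state R (forEach (verticesOfStage l) (λ v E → updateAt E v (λ X → Comp X v R)) E)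

  module Replace (l : ℕ) (E : Labels) where

    part : RFamily → Edge → EdgeSet
    part R e =
      ⋃ (List.map (λ v → [ R e ∩ Comp (E v) v R ] tgt e ⇝ v) (verticesOfStage l))

    replace : RFamily → Edge → EdgeSet
    replace R e = (R e ─ R e [ suc (stageᵉ e) ∶ l ]) ∪ part R e

    update : Edge → RFamily → RFamily
    update e R = updateAt R e (const ([ replace R e ] tgt e ⇝ D))

  step₂₃ : ℕ → State → State
  step₂₃ l (state R E) =
    state (forEach (edgesUpToStage l) (Replace.update l E) R) E

  step₂-at : ℕ → State → State
  step₂-at l = step₂₃ l ∘ step₂₂ l ∘ step₂₁ l

  step₂ : State → State
  step₂ = forEach (applyUpTo suc (L ∸ 1)) step₂-at

  private
    ⋃-⊆ : ∀ {A : Set} (h : A → EdgeSet) {Y} → (∀ x → h x ⊆ Y) →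
          ∀ xs → ⋃ (List.map h xs) ⊆ Y
    ⋃-⊆ h h⊆ []       = ⊥⊆
    ⋃-⊆ h h⊆ (x ∷ xs) = [ h⊆ x , ⋃-⊆ h h⊆ xs ]′ ∘ x∈p∪q⁻ (h x) _

    update-⊑ : ∀ l E e R → Replace.update l E e R ⊑ R
    update-⊑ l E e R = ChangeLoop.updateAt-⊑ E e R e
      (part-⊆ ∘ []⊆ (Replace.replace l E R e) (tgt e) D)
      where
      part-⊆ : Replace.replace l E R e ⊆ R e
      part-⊆ = [ p─q⊆p (R e) (R e [ suc (stageᵉ e) ∶ l ])
               , ⋃-⊆ (λ v → [ R e ∩ Comp (E v) v R ] tgt e ⇝ v)
                   (λ v → p∩q⊆p (R e) (Comp (E v) v R) ∘ []⊆ (R e ∩ Comp (E v) v R) (tgt e) v)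
                   (verticesOfStage l)
               ]′ ∘ x∈p∪q⁻ (R e ─ R e [ suc (stageᵉ e) ∶ l ]) (Replace.part l E R e)

    step₂-at-⊑ : ∀ l s → R (step₂-at l s) ⊑ R s
    step₂-at-⊑ l s = ⊑-trans (R (step₂-at l s)) (R s₁) (R s)
      (forEach-inv (_⊑ R s₁) (Replace.update l (E s₂))
        (λ e R′ → ⊑-trans (Replace.update l (E s₂) e R′) R′ (R s₁)
                    (update-⊑ l (E s₂) e R′))
        (edgesUpToStage l) (R s₁) (λ _ → id))
      (forEach-inv (_⊑ R s) (Change (E s))
        (λ e R′ → ⊑-trans (Change (E s) e R′) R′ (R s)
                    (ChangeLoop.repeat-⊑ (E s) e R′))
        (edgesOfStage l) (R s) (λ _ → id))
      where
      s₁ : State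
      s₁ = step₂₁ l s

      s₂ : State
      s₂ = step₂₂ l s₁

    step₂-⊑ : ∀ s → R (step₂ s) ⊑ R s
    step₂-⊑ s = forEach-inv (λ s′ → R s′ ⊑ R s) step₂-at
      (λ l s′ → ⊑-trans (R (step₂-at l s′)) (R s′) (R s) (step₂-at-⊑ l s′))
      (applyUpTo suc (L ∸ 1)) s (λ _ → id)

    decreases : ∀ s → ¬ (∀ e → R s e ≡ R (step₂ s) e) →
                ∣ R (step₂ s) ∣ᶠ < ∣ R s ∣ᶠ
    decreases s ¬eq =
      [ (λ eq → contradiction eq ¬eq) , id ]′
        (⊆⇒≡⊎∣<∣ᶠ (R (step₂ s)) (R s) (step₂-⊑ s))

  module MainLoop =
    Repeat step₂ (λ s s′ → all? (λ e → R s e ≟ˢ R s′ e)) (λ s → ∣ R s ∣ᶠ) decreases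

  -- The state after steps 1-3.
  ZH : State
  ZH = MainLoop.repeat (state (Init label) label)

{-# OPTIONS --safe #-}

-- Let e₁, …, e_L be the edges of a simple path S - v₁ - … - v_L.  Every step of
-- the algorithm preserves the two properties
--   e_i ∈ E(v_l) for i ≤ l   and   e_k ∈ R(e_i) for i < k:
-- the segment of the simple path between two of its vertices is itself a witness
-- for every reachability test that could lead to the deletion of one of its
-- edges.  In particular Comp(E(D), D, R(E)) contains e₁, …, e_L at the end.

module Submission where

open import Defs
open import Data.Fin.Base using (Fin; zero; suc; inject₁; fromℕ; fromℕ<; toℕ)
open import Data.Fin.Induction using (<-weakInduction)
import Data.Fin.Properties as Fin
open import Data.Fin.Subset using (Subset; Nonempty; _∈_; _∩_; _─_; ⋃)
open import Data.Fin.Subset.Properties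
  using (x∈p∩q⁺; x∈p∪q⁺; x∈p∧x≢y⇒x∈p-y; x∈p∧x∉q⇒x∈p─q)
open import Data.List.Base using (List)
import Data.List.Base as List
open import Data.List.Membership.Propositional using () renaming (_∈_ to _∈ˡ_)
open import Data.List.Membership.Propositional.Properties using (∈-allFin; ∈-filter⁺)
open import Data.List.Relation.Unary.All using (All; []; _∷_)
open import Data.List.Relation.Unary.All.Properties using (applyUpTo⁺₁)
open import Data.List.Relation.Unary.Any using (here; there)
open import Data.Nat.Base using (ℕ; zero; suc; _∸_; _≤_; _<_; _≰_; z≤n; s≤s)
import Data.Nat.Properties as ℕ
open import Data.Product.Base using (_×_; _,_; proj₁; proj₂)
open import Data.Sum.Base using (inj₁; inj₂; map; swap)
open import Data.Vec.Functional using (updateAt)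
open import Data.Vec.Functional.Properties using (updateAt-updates; updateAt-minimal)
open import Function.Base using (_∘_)
open import Relation.Binary.Construct.Closure.ReflexiveTransitive using (ε; _◅_; _◅◅_)
open import Relation.Binary.PropositionalEquality
  using (_≡_; refl; sym; trans; cong; subst; subst₂)
open import Relation.Nullary using (yes; no)
open import Relation.Nullary.Decidable using (toSum)

-- Loops, pointwise updates and finite unions.

-- The body may use a property of the visited elements: step 2.3 needs its stage `l` to satisfy
-- `l < L`.
forEach-inv-All : {A B : Set} (P : B → Set) {Q : A → Set} (body : A → B → B) →
                  (∀ x s → Q x → P s → P (body x s)) →
                  ∀ {xs} → All Q xs → ∀ s → P s → P (forEach xs body s)
forEach-inv-All P body step []         s ps = ps
forEach-inv-All P body step (qx ∷ qxs) s ps =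
  forEach-inv-All P body step qxs (body _ s) (step _ s qx ps)

updateAt-elim : ∀ {n} {B : Set} (P : B → Set) (f : Fin n → B) d {h : B → B} e →
                (e ≡ d → P (h (f e))) → P (f e) → P (updateAt f d h e)
updateAt-elim P f d e ph p with e Fin.≟ d
... | yes refl = subst P (sym (updateAt-updates d f)) (ph refl)
... | no  e≢d  = subst P (sym (updateAt-minimal e d f e≢d)) p

⋃-∈ : ∀ {n} {A : Set} (h : A → Subset n) {a x} →
      ∀ {as} → a ∈ˡ as → x ∈ h a → x ∈ ⋃ (List.map h as)
⋃-∈ h (here refl) x∈ = x∈p∪q⁺ (inj₁ x∈)
⋃-∈ h (there a∈)  x∈ = x∈p∪q⁺ (inj₂ (⋃-∈ h a∈ x∈))

module _ {G : LabeledMultistageGraph} (p : SimplePath G) where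
  open LabeledMultistageGraph G
  open SimplePath p
  open Operators G

  -- Segments of the simple path.

  stage-vertex : ∀ i → stage (vertex i) ≡ toℕ i
  stage-vertex = <-weakInduction (λ i → stage (vertex i) ≡ toℕ i)
    (trans (cong stage starts) stage-S)
    (λ i eq → trans (cong stage (sym (edge-tgt i)))
                (trans (src-tgt (edge i))
                  (cong suc (trans (cong stage (edge-src i))
                              (trans eq (Fin.toℕ-inject₁ i))))))

  stage-edge : ∀ k → stageᵉ (edge k) ≡ suc (toℕ k)
  stage-edge k = trans (cong stage (edge-tgt k)) (stage-vertex (suc k))

  stage-edge-< : ∀ {i k} → toℕ i < toℕ k → stageᵉ (edge i) < stageᵉ (edge k)
  stage-edge-< {i} {k} i<k =
    subst₂ _<_ (sym (stage-edge i)) (sym (stage-edge k)) (s≤s i<k)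

  -- `edge k` leads from `vertex k` to `vertex (suc k)`, and so has stage k + 1.
  Segment : Fin (suc L) → Fin (suc L) → EdgeSet → Set
  Segment i l X = ∀ k → toℕ i ≤ toℕ k → toℕ k < toℕ l → edge k ∈ X

  segment-path : ∀ {X} i l → toℕ i ≤ toℕ l → Segment i l X →
                 Path X (vertex i) (vertex l)
  segment-path {X} i = <-weakInduction
    (λ l → toℕ i ≤ toℕ l → Segment i l X → Path X (vertex i) (vertex l))
    base step
    where
    base : toℕ i ≤ 0 → Segment i zero X → Path X (vertex i) (vertex zero)
    base i≤0 _ with Fin.toℕ-injective {i = i} {j = zero} (ℕ.n≤0⇒n≡0 i≤0)
    ... | refl = ε

    step : ∀ k →
           (toℕ i ≤ toℕ (inject₁ k) → Segment i (inject₁ k) X →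
             Path X (vertex i) (vertex (inject₁ k))) →
           toℕ i ≤ suc (toℕ k) → Segment i (suc k) X →
           Path X (vertex i) (vertex (suc k))
    step k ih i≤sk seg with i Fin.≟ suc k
    -- The induction on `l` may start only here, with an empty segment; otherwise `edge k` is
    -- appended to a shorter path.
    ... | yes refl = ε
    ... | no i≢sk =
      ih (subst (toℕ i ≤_) (sym (Fin.toℕ-inject₁ k)) i≤k)
         (λ j i≤j j<k → seg j i≤j
           (ℕ.m<n⇒m<1+n (subst (toℕ j <_) (Fin.toℕ-inject₁ k) j<k)))
      ◅◅ (edge k , seg k i≤k ℕ.≤-refl , edge-src k , edge-tgt k) ◅ ε
      where
      i≤k : toℕ i ≤ toℕ k
      i≤k = ℕ.≤-pred (ℕ.≤∧≢⇒< i≤sk (i≢sk ∘ Fin.toℕ-injective))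

  -- An edge of the segment cuts it into two shorter segments, which are the two paths that `join`
  -- needs. The equations let `S`, `D` and `tgt (edge i)` serve as end points.
  segment-[] : ∀ {X u v} i l → u ≡ vertex i → v ≡ vertex l → Segment i l X →
               Segment i l ([ X ] u ⇝ v)
  segment-[] {X} {u} {v} i l refl refl seg k i≤k k<l =
    ∈⟪⟫⁺ (onSomePath? X u v) (join (seg k i≤k k<l)
      (subst (Path X u) (sym (edge-src k))
        (segment-path i (inject₁ k) (subst (toℕ i ≤_) (sym ≡k) i≤k)
          λ j i≤j j<k → seg j i≤j (ℕ.<-trans (subst (toℕ j <_) ≡k j<k) k<l)))
      (subst (λ w → Path X w v) (sym (edge-tgt k))
        (segment-path (suc k) l k<l
          λ j k<j j<l → seg j (ℕ.≤-trans i≤k (ℕ.<⇒≤ k<j)) j<l)))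
    where
    ≡k : toℕ (inject₁ k) ≡ toℕ k
    ≡k = Fin.toℕ-inject₁ k

  <L⇒<fromℕL : ∀ {m} → m < L → m < toℕ (fromℕ L)
  <L⇒<fromℕL = subst (_ <_) (sym (Fin.toℕ-fromℕ L))

  -- The invariants and their preservation by `Comp`.

  RInv : RFamily → Set
  RInv R = ∀ i k → toℕ i < toℕ k → edge k ∈ R (edge i)

  -- For `l = zero` the segment is empty, so nothing is demanded of the label of `S`.
  LabelInv : Labels → Set
  LabelInv E = ∀ l → Segment zero l (E (vertex l))

  Comp-segment : ∀ {R ES v} l → v ≡ vertex l → RInv R → Segment zero l ES →
                 Segment zero l (Comp ES v R)
  Comp-segment {R} {ES} l refl rinv =
    repeat-inv (Segment zero l)
      (λ T seg → segment-[] zero l (sym starts) refl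
        (forEach-inv (Segment zero l) prune prune-segment (elements T) T seg))
      ES
    where
    open CompLoop (vertex l) R

    prune-segment : ∀ e T → Segment zero l T → Segment zero l (prune e T)
    prune-segment e T seg =
      if-elim (Segment zero l) (path? ([ R e ∩ T ] tgt e ⇝ vertex l) (tgt e) (vertex l))
        (λ _ → seg)
        -- If the deleted edge were `edge k`, the rest of the segment would lie in `R e ∩ T` and be
        -- the path that the test failed to find.
        (λ ¬path k 0≤k k<l → x∈p∧x≢y⇒x∈p-y (seg k 0≤k k<l)
          λ { refl → ¬path (subst (λ w → Path ([ R e ∩ T ] tgt e ⇝ vertex l) w (vertex l))
                              (sym (edge-tgt k))
                              (segment-path (suc k) l k<l
                                (segment-[] (suc k) l (edge-tgt k) refl
                                  λ j k<j j<l → x∈p∩q⁺ (rinv k j k<j , seg j z≤n j<l)))) })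

  R∩Comp-segment : ∀ {R E v} i l → v ≡ vertex l → RInv R → LabelInv E →
                   Segment (suc i) l ([ R (edge i) ∩ Comp (E v) v R ] tgt (edge i) ⇝ v)
  R∩Comp-segment i l refl rinv linv = segment-[] (suc i) l (edge-tgt i) refl
    λ k i<k k<l → x∈p∩q⁺ (rinv i k i<k , Comp-segment l refl rinv (linv l) k z≤n k<l)

  -- The simple path ends in `D`, so everything after `edge i` is a segment from `tgt (edge i)` to
  -- `D`.
  restrict-RInv : ∀ {X} i → (∀ k → toℕ i < toℕ k → edge k ∈ X) →
                  ∀ k → toℕ i < toℕ k → edge k ∈ [ X ] tgt (edge i) ⇝ D
  restrict-RInv i X∋ k i<k =
    segment-[] (suc i) (fromℕ L) (edge-tgt i) (sym ends) (λ j i<j _ → X∋ j i<j)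
      k i<k (<L⇒<fromℕL (Fin.toℕ<n k))

  -- The invariants after initialisation.

  LabelInv-label : LabelInv label
  LabelInv-label (suc l) k _ (s≤s k≤l) = labeled k≤l

  -- By `i < k`, already the source of `edge k` comes after `edge i`, so the labels of both end
  -- points contain `edge i`.
  RInv-Init : RInv (Init label)
  RInv-Init i = restrict-RInv i λ k i<k →
    ∈⟪⟫⁺ (initEdge? label (edge i))
      ( stage-edge-< i<k
      , x∈p∩q⁺ ( subst (λ w → edge i ∈ label w) (sym (edge-src k))
                   (LabelInv-label (inject₁ k) i z≤n
                     (subst (toℕ i <_) (sym (Fin.toℕ-inject₁ k)) i<k))
               , subst (λ w → edge i ∈ label w) (sym (edge-tgt k))
                   (labeled (ℕ.<⇒≤ i<k))))

  -- Preservation of `RInv` by `Change` and by the replacement in step 2.3.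

  module _ {E : Labels} (linv : LabelInv E) where

    RInv-Change : ∀ e R → RInv R → RInv (Change E e R)
    RInv-Change e = repeat-inv RInv λ R rinv →
      restrict-inv (forEach (laterEdges R) test R)
        (forEach-inv RInv test test-inv (laterEdges R) R rinv)
      where
      open ChangeLoop E e

      laterEdges : RFamily → List Edge
      laterEdges R = List.filter (λ f → l ℕ.<? stageᵉ f) (elements (R e))

      restrict-inv : ∀ R → RInv R → RInv (restrict R)
      restrict-inv R rinv i = updateAt-elim
        (λ X → ∀ k → toℕ i < toℕ k → edge k ∈ X) R e (edge i)
        (λ { refl → restrict-RInv i (rinv i) }) (rinv i)

      keep : ∀ {R} n i k → toℕ i ≡ n → e ≡ edge i → toℕ i < toℕ k → RInv R →
             Keep R (edge k)
      -- The first edge starts at `S`, where the test is passed without candidates.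
      keep zero i k i≡ refl i<k rinv = inj₁ (trans (edge-src i)
        (trans (cong vertex (Fin.toℕ-injective {j = zero}
          (trans (Fin.toℕ-inject₁ i) i≡))) starts))
      keep {R} (suc m) i k i≡ refl i<k rinv = inj₂
        -- All path edges before `edge i` are candidates and survive `Comp`; its immediate
        -- predecessor witnesses nonemptiness.
        ( edge j
        , Comp-segment (inject₁ i) (edge-src i) rinv
            (segment-[] zero (inject₁ i) (sym starts) (edge-src i)
              λ h _ h<i → ∈⟪⟫⁺ (candidate? R (edge k))
                (candidate h (subst (toℕ h <_) (Fin.toℕ-inject₁ i) h<i)))
            j z≤n (subst (toℕ j <_) (sym (Fin.toℕ-inject₁ i)) j<i) )
        where
        m<L : m < L
        m<L = ℕ.<-trans (subst (m <_) (sym i≡) ℕ.≤-refl) (Fin.toℕ<n i)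

        j : Fin L
        j = fromℕ< m<L

        j<i : toℕ j < toℕ i
        j<i = ℕ.≤-reflexive (trans (cong suc (Fin.toℕ-fromℕ< m<L)) (sym i≡))

        candidate : ∀ h → toℕ h < toℕ i → Candidate R (edge k) (edge h)
        candidate h h<i =
            stage-edge-< h<i
          -- Both `edge i` and `edge k` lie on the segment that follows `edge h` and ends with
          -- `edge k`.
          , X∋ i h<i (ℕ.m<n⇒m<1+n i<k)
          , X∋ k (ℕ.<-trans h<i i<k) ℕ.≤-refl
          where
          X∋ : Segment (suc h) (suc k)
                 ([ R (edge h) ∩ Comp (E (tgt (edge k))) (tgt (edge k)) R ]
                    tgt (edge h) ⇝ tgt (edge k))
          X∋ = R∩Comp-segment {E = E} h (suc k) (edge-tgt k) rinv linv

      test-inv : ∀ f R → RInv R → RInv (test f R)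
      test-inv f R rinv = if-elim RInv (keep? R f) (λ _ → rinv)
        λ ¬keep i k i<k → updateAt-elim (edge k ∈_) R e (edge i)
          (λ { refl → x∈p∧x≢y⇒x∈p-y (rinv i k i<k)
                 λ { refl → ¬keep (keep (toℕ i) i k refl refl i<k rinv) } })
          (rinv i k i<k)

    -- Path edges of stage at most `l` reappear in the union, in the term of the path's own vertex
    -- of stage `l`; those of larger stage are outside the replaced part.
    RInv-update : ∀ {l} → l < L → ∀ e R → RInv R → RInv (Replace.update l E e R)
    RInv-update {l} l<L e R rinv i = updateAt-elim
      (λ X → ∀ k → toℕ i < toℕ k → edge k ∈ X) R e (edge i)
      (λ { refl → restrict-RInv i replace-∋ }) (rinv i)
      where
      open Replace l E

      v : Vertex
      v = vertex (fromℕ< (ℕ.m<n⇒m<1+n l<L))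

      toℕ-v : toℕ (fromℕ< (ℕ.m<n⇒m<1+n l<L)) ≡ l
      toℕ-v = Fin.toℕ-fromℕ< (ℕ.m<n⇒m<1+n l<L)

      replaced : ∀ k → toℕ i < toℕ k → stageᵉ (edge k) ≤ l → edge k ∈ part R (edge i)
      replaced k i<k k≤l = ⋃-∈ (λ w → [ R (edge i) ∩ Comp (E w) w R ] tgt (edge i) ⇝ w)
        (∈-filter⁺ (λ w → stage w ℕ.≟ l) (∈-allFin v) (trans (stage-vertex _) toℕ-v))
        (R∩Comp-segment {E = E} i (fromℕ< (ℕ.m<n⇒m<1+n l<L)) refl rinv linv k i<k
          (subst (toℕ k <_) (sym toℕ-v) (subst (_≤ l) (stage-edge k) k≤l)))

      kept : ∀ k → toℕ i < toℕ k → stageᵉ (edge k) ≰ l →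
             edge k ∈ R (edge i) ─ R (edge i) [ suc (stageᵉ (edge i)) ∶ l ]
      kept k i<k k≰l = x∈p∧x∉q⇒x∈p─q (rinv i k i<k)
        (k≰l ∘ proj₂ ∘ proj₂ ∘
          ∈⟪⟫⁻ (between? (R (edge i)) (suc (stageᵉ (edge i))) l))

      replace-∋ : ∀ k → toℕ i < toℕ k → edge k ∈ replace R (edge i)
      replace-∋ k i<k = x∈p∪q⁺
        (swap (map (replaced k i<k) (kept k i<k) (toSum (stageᵉ (edge k) ℕ.≤? l))))

  -- The invariant of the whole algorithm and the conclusion.

  Inv : State → Set
  Inv (state R E) = RInv R × LabelInv E

  Inv-step₂₁ : ∀ l s → Inv s → Inv (step₂₁ l s)
  Inv-step₂₁ l (state R E) (rinv , linv) =
    forEach-inv RInv (Change E) (RInv-Change {E = E} linv) (edgesOfStage l) R rinv , linv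

  Inv-step₂₂ : ∀ l s → Inv s → Inv (step₂₂ l s)
  Inv-step₂₂ l (state R E) (rinv , linv) =
    rinv , forEach-inv LabelInv _
      (λ v E′ linv′ i → updateAt-elim (Segment zero i) E′ v (vertex i)
        (λ { refl → Comp-segment i refl rinv (linv′ i) }) (linv′ i))
      (verticesOfStage l) E linv

  Inv-step₂₃ : ∀ {l} → l < L → ∀ s → Inv s → Inv (step₂₃ l s)
  Inv-step₂₃ {l} l<L (state R E) (rinv , linv) =
    forEach-inv RInv (Replace.update l E) (RInv-update {E = E} linv l<L) (edgesUpToStage l) R rinv
    , linv

  Inv-step₂ : ∀ s → Inv s → Inv (step₂ s)
  Inv-step₂ = forEach-inv-All Inv step₂-at
    (λ l s l<L inv → Inv-step₂₃ l<L (step₂₂ l (step₂₁ l s))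
      (Inv-step₂₂ l (step₂₁ l s) (Inv-step₂₁ l s inv)))
    -- The stages visited are `suc i` with `i < L ∸ 1`; by `1 ≤ L` this gives `suc i < L`.
    (applyUpTo⁺₁ suc (L ∸ 1) λ i<L∸1 →
      ℕ.≤-trans (s≤s i<L∸1) (ℕ.≤-reflexive (ℕ.m+[n∸m]≡n 1≤L)))

  Inv-ZH : Inv ZH
  Inv-ZH = MainLoop.repeat-inv Inv Inv-step₂ (state (Init label) label)
    (RInv-Init , LabelInv-label)

theorem2 : (G : LabeledMultistageGraph) → SimplePath G →
    let open LabeledMultistageGraph G
        open Operators G
        open State ZH
    in Nonempty (Comp (E D) D R)
theorem2 G p =
  -- All edges of the path survive the final `Comp`; `1 ≤ L` provides a first one.
  edge first , Comp-segment p (fromℕ L) (sym ends) (proj₁ (Inv-ZH p))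
    (subst (λ v → Segment p zero (fromℕ L) (E v)) ends (proj₂ (Inv-ZH p) (fromℕ L)))
    first z≤n (<L⇒<fromℕL p (Fin.toℕ<n first))
  where
  open LabeledMultistageGraph G
  open SimplePath p
  open Operators G
  open State ZH

  first : Fin L
  first = fromℕ< 1≤L
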